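{- For any finite simple graph $G$, $c_2(G)\leq 2\tau(G)$.
   Context: All graphs are finite and simple. A subgraph complementation system for a graph $G=(V,E)$ is a finite collection (family) $\mathscr{C}$ of subsets of $V$ such that, for any two distinct vertices $u,v\in V$, $uv\in E$ if and only if $u$ and $v$ appear together in an odd number of sets in $\mathscr{C}$. The subgraph complementation number $c_2(G)$ is the minimum cardinality of a subgraph complementation system for $G$. $\tau(G)$ denotes the minimum cardinality of a vertex cover of $G$, i.e. of a set of vertices such that every edge of $G$ is incident to at least one vertex in the set. -}

module Defs where

open import Level using (0ℓ)
open import Data.Bool using (true; false; _∧_)
open import Data.Bool.Properties using (∧-comm)
open import Data.Fin using (Fin; zero; suc; _≟_)
open import Data.Fin.Properties using (all?; suc-injective)
open import Data.Fin.Subset using (Subset; inside; outside; _∈_; ∣_∣; ⊤)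
open import Data.Fin.Subset.Properties using (_∈?_; anySubset?; ∈⊤)
open import Data.Nat as ℕ using (ℕ; zero; suc; _≤_; z≤n; s≤s; parity)
open import Data.Parity using (1ℙ)
open import Data.Parity.Properties as ℙ using ()
open import Data.Product using (∃; _×_; _,_; proj₁; proj₂)
open import Data.Sum using (_⊎_; inj₁)
open import Data.Vec using (Vec; []; _∷_; count; map; tabulate)
open import Data.Vec.Properties using ([]=⇒lookup; lookup⇒[]=; lookup∘tabulate)
open import Function using (_∘_; _⇔_; mk⇔; Equivalence)
open import Relation.Binary using (Rel; Symmetric; Irreflexive)
import Relation.Binary as B
open import Relation.Binary.PropositionalEquality
open import Relation.Nullary using (Dec; does; yes; no; contradiction)
open import Relation.Nullary.Decidable
  using (map′; _×-dec_; _⊎-dec_; _→-dec_; ¬?; dec-true)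
open import Relation.Unary using (Pred; Decidable)

-- Decidability of adjacency is automatic classically; it is a field so that
-- the graph parameters below are computable.
record Graph (n : ℕ) : Set₁ where
  field
    Adj        : Rel (Fin n) 0ℓ
    adj-sym    : Symmetric Adj
    adj-irrefl : Irreflexive _≡_ Adj
    adj?       : B.Decidable Adj

IsMinimum : Pred ℕ 0ℓ → ℕ → Set
IsMinimum P m = P m × (∀ k → P k → m ≤ k)

minimum : {P : Pred ℕ 0ℓ} → Decidable P → ∀ k → P k → ∃ (IsMinimum P)
minimum P? k p with P? 0
minimum P? k p | yes p₀ = 0 , p₀ , λ _ _ → z≤n
minimum P? zero p | no ¬p₀ = contradiction p ¬p₀
minimum P? (suc k) p | no ¬p₀ with minimum (P? ∘ suc) k p
... | m , pm , m≤ = suc m , pm , λ where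
  zero    p₀ → contradiction p₀ ¬p₀
  (suc j) pj → s≤s (m≤ j pj)

Odd : ℕ → Set
Odd m = parity m ≡ 1ℙ

-- Families are indexed: a repeated set is counted with multiplicity, here and
-- in the cardinality k. This does not affect minimum cardinalities, since
-- dropping two equal members preserves the parity of joint.
joint : ∀ {n k} → Fin n → Fin n → Vec (Subset n) k → ℕ
joint u v = count (λ S → u ∈? S ×-dec v ∈? S)

module _ {n : ℕ} (G : Graph n) where
  open Graph G

  IsComplementationSystem : ∀ {k} → Vec (Subset n) k → Set
  IsComplementationSystem C =
    ∀ u v → u ≢ v → Adj u v ⇔ Odd (joint u v C)

  HasComplementationSystem : ℕ → Set
  HasComplementationSystem k = ∃ λ (C : Vec (Subset n) k) → IsComplementationSystem C

  IsVertexCover : Subset n → Set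
  IsVertexCover S = ∀ u v → Adj u v → u ∈ S ⊎ v ∈ S

  HasVertexCover : ℕ → Set
  HasVertexCover k = ∃ λ S → IsVertexCover S × ∣ S ∣ ≡ k

_⇔-dec_ : {A B : Set} → Dec A → Dec B → Dec (A ⇔ B)
a? ⇔-dec b? =
  map′ (λ (f , g) → mk⇔ f g) (λ e → Equivalence.to e , Equivalence.from e)
       ((a? →-dec b?) ×-dec (b? →-dec a?))

anyFamily? : ∀ {n k} {P : Pred (Vec (Subset n) k) 0ℓ} → Decidable P → Dec (∃ P)
anyFamily? {k = zero} P? = map′ (λ p → [] , p) (λ { ([] , p) → p }) (P? [])
anyFamily? {k = suc k} P? =
  map′ (λ (S , C , p) → S ∷ C , p) (λ { (S ∷ C , p) → S , C , p })
       (anySubset? λ S → anyFamily? λ C → P? (S ∷ C))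

hasComplementationSystem? : ∀ {n} (G : Graph n) → Decidable (HasComplementationSystem G)
hasComplementationSystem? G k = anyFamily? λ C → all? λ u → all? λ v →
  ¬? (u ≟ v) →-dec (Graph.adj? G u v ⇔-dec (parity (joint u v C) ℙ.≟ 1ℙ))

hasVertexCover? : ∀ {n} (G : Graph n) → Decidable (HasVertexCover G)
hasVertexCover? G k = anySubset? λ S →
  (all? λ u → all? λ v → Graph.adj? G u v →-dec (u ∈? S ⊎-dec v ∈? S))
  ×-dec (∣ S ∣ ℕ.≟ k)

∃-vertexCover : ∀ {n} (G : Graph n) → ∃ (HasVertexCover G)
∃-vertexCover {n} G = ∣ ⊤ {n} ∣ , ⊤ , (λ _ _ _ → inj₁ ∈⊤) , refl

-- Every graph has a system: with N the neighbourhood of vertex 0, the sets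
-- N ∪ {0} and N together realise exactly the edges at 0; recurse on G - 0.

private
  joint-comm : ∀ {n k} u v (C : Vec (Subset n) k) → joint u v C ≡ joint v u C
  joint-comm u v [] = refl
  joint-comm u v (S ∷ C)
    rewrite ∧-comm (does (u ∈? S)) (does (v ∈? S)) | joint-comm u v C = refl

  joint-zero : ∀ {n k} v (C : Vec (Subset n) k) → joint zero v (map (outside ∷_) C) ≡ 0
  joint-zero v []      = refl
  joint-zero v (S ∷ C) = joint-zero v C

  joint-suc : ∀ {n k} u v (C : Vec (Subset n) k) →
              joint (suc u) (suc v) (map (outside ∷_) C) ≡ joint u v C
  joint-suc u v [] = refl
  joint-suc u v (S ∷ C) rewrite joint-suc u v C = refl

  delete-zero : ∀ {n} → Graph (suc n) → Graph n
  delete-zero G = record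
    { Adj        = λ u v → Adj (suc u) (suc v)
    ; adj-sym    = adj-sym
    ; adj-irrefl = λ { refl → adj-irrefl refl }
    ; adj?       = λ u v → adj? (suc u) (suc v)
    } where open Graph G

∃-complementationSystem : ∀ {n} (G : Graph n) → ∃ (HasComplementationSystem G)
∃-complementationSystem {zero}  G = 0 , [] , λ ()
∃-complementationSystem {suc n} G with ∃-complementationSystem (delete-zero G)
... | k , C , isC = suc (suc k) , C′ , isC′
  where
  open Graph G

  N : Subset n
  N = tabulate λ v → does (adj? zero (suc v))

  C′ : Vec (Subset (suc n)) (suc (suc k))
  C′ = (inside ∷ N) ∷ (outside ∷ N) ∷ map (outside ∷_) C

  ∈N⇒adj : ∀ v → v ∈ N → Adj zero (suc v)
  ∈N⇒adj v v∈N
    with adj? zero (suc v)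
       | trans (sym (lookup∘tabulate (λ v → does (adj? zero (suc v))) v)) ([]=⇒lookup v∈N)
  ... | yes a | _ = a

  adj⇒∈N : ∀ v → Adj zero (suc v) → v ∈ N
  adj⇒∈N v a = lookup⇒[]= v N (trans (lookup∘tabulate _ v) (dec-true (adj? zero (suc v)) a))

  at-zero : ∀ v → Adj zero (suc v) ⇔ Odd (joint zero (suc v) C′)
  at-zero v rewrite joint-zero (suc v) C with v ∈? N
  ... | yes v∈N = mk⇔ (λ _ → refl) (λ _ → ∈N⇒adj v v∈N)
  ... | no  v∉N = mk⇔ (λ a → contradiction (adj⇒∈N v a) v∉N) (λ ())

  isC′ : IsComplementationSystem G C′
  isC′ zero zero 0≢0 = contradiction refl 0≢0
  isC′ zero (suc v) _ = at-zero v
  isC′ (suc u) zero _ rewrite joint-comm (suc u) zero C′ =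
    mk⇔ (Equivalence.to (at-zero u) ∘ adj-sym) (adj-sym ∘ Equivalence.from (at-zero u))
  isC′ (suc u) (suc v) u≢v rewrite joint-suc u v C
    with does (u ∈? N) ∧ does (v ∈? N)
  ... | true  = isC u v (u≢v ∘ cong suc)
  ... | false = isC u v (u≢v ∘ cong suc)

module _ {n : ℕ} (G : Graph n) where

  c₂-minimum : ∃ (IsMinimum (HasComplementationSystem G))
  c₂-minimum = let (k , C) = ∃-complementationSystem G in
    minimum (hasComplementationSystem? G) k C

  c₂ : ℕ
  c₂ = proj₁ c₂-minimum

  τ-minimum : ∃ (IsMinimum (HasVertexCover G))
  τ-minimum = let (k , S) = ∃-vertexCover G in
    minimum (hasVertexCover? G) k S

  τ : ℕ
  τ = proj₁ τ-minimum

{-# OPTIONS --safe #-}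
-- If v lies in a vertex cover S, then with N the neighbourhood of v the two
-- sets N ∪ {v} and N jointly toggle exactly the edges at v. Removing those
-- edges leaves a graph covered by S - v, so τ G rounds suffice.
module Submission where

open import Data.Nat using (ℕ; zero; suc; _≤_; _*_; z≤n; s≤s; s≤s⁻¹)
open import Data.Nat.Properties using (≤-trans; ≤-reflexive; <-≤-trans; *-comm)
open import Data.Bool.Properties using (∧-comm)
open import Data.Fin using (Fin; _≟_)
open import Data.Fin.Subset using (Subset; _∈_; _∉_; _∪_; _-_; ⁅_⁆; ∣_∣)
open import Data.Fin.Subset.Properties
  using (_∈?_; nonempty?; x∈p∪q⁺; x∈p∪q⁻; x∈⁅x⁆; x∈⁅y⁆⇒x≡y; x∈p∧x≢y⇒x∈p-y; x∈p⇒∣p-x∣<∣p∣)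
open import Data.Product using (_×_; _,_; proj₁; proj₂)
open import Data.Sum as Sum using (inj₁; inj₂; [_,_]′)
open import Data.Vec using (Vec; []; _∷_; tabulate)
open import Data.Vec.Properties using ([]=⇒lookup; lookup⇒[]=; lookup∘tabulate)
open import Function using (_∘_; id; _⇔_; mk⇔; Equivalence)
open import Relation.Binary.PropositionalEquality
open import Relation.Nullary using (¬_; does; yes; no; contradiction)
open import Relation.Nullary.Decidable using (_×-dec_; ¬?; dec-true; dec-false)
open import Defs
  using (Graph; c₂; τ; Odd; joint; IsComplementationSystem; IsVertexCover; c₂-minimum; τ-minimum)

private
  variable
    n k : ℕ

joint-comm : ∀ u w (C : Vec (Subset n) k) → joint u w C ≡ joint w u C
joint-comm u w [] = refl
joint-comm u w (S ∷ C)
  rewrite ∧-comm (does (u ∈? S)) (does (w ∈? S)) | joint-comm u w C = refl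

joint-∷-∈ : ∀ {u w : Fin n} {S} (C : Vec (Subset n) k) →
            u ∈ S → w ∈ S → joint u w (S ∷ C) ≡ suc (joint u w C)
joint-∷-∈ {u = u} {w} {S} C u∈S w∈S
  rewrite dec-true (u ∈? S ×-dec w ∈? S) (u∈S , w∈S) = refl

joint-∷-∉ : ∀ {u w : Fin n} {S} (C : Vec (Subset n) k) →
            ¬ (u ∈ S × w ∈ S) → joint u w (S ∷ C) ≡ joint u w C
joint-∷-∉ {u = u} {w} {S} C ∉S
  rewrite dec-false (u ∈? S ×-dec w ∈? S) ∉S = refl

¬odd⇒odd-suc : ∀ m → ¬ Odd m → Odd (suc m)
¬odd⇒odd-suc zero          _    = refl
¬odd⇒odd-suc (suc zero)    ¬odd = contradiction refl ¬odd
¬odd⇒odd-suc (suc (suc m)) ¬odd = ¬odd⇒odd-suc m ¬odd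

module _ (G : Graph n) (v : Fin n) where
  open Graph G

  -- `v` stays as an isolated vertex, so subsets that form a system here are also subsets of the
  -- vertices of `G` and need no relabelling.
  deleteEdgesAt : Graph n
  deleteEdgesAt = record
    { Adj        = λ u w → Adj u w × u ≢ v × w ≢ v
    ; adj-sym    = λ (uw , u≢v , w≢v) → adj-sym uw , w≢v , u≢v
    ; adj-irrefl = λ u≡w (uw , _) → adj-irrefl u≡w uw
    ; adj?       = λ u w → adj? u w ×-dec ¬? (u ≟ v) ×-dec ¬? (w ≟ v)
    }

  neighbours : Subset n
  neighbours = tabulate (does ∘ adj? v)

  ∈neighbours⁺ : ∀ {w} → Adj v w → w ∈ neighbours
  ∈neighbours⁺ {w} vw =
    lookup⇒[]= w _ (trans (lookup∘tabulate _ w) (dec-true (adj? v w) vw))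

  ∈neighbours⁻ : ∀ {w} → w ∈ neighbours → Adj v w
  ∈neighbours⁻ {w} w∈N
    with adj? v w | trans (sym (lookup∘tabulate (does ∘ adj? v) w)) ([]=⇒lookup w∈N)
  ... | yes vw | _ = vw

  closedNeighbours : Subset n
  closedNeighbours = neighbours ∪ ⁅ v ⁆

  ∈closedNeighbours⁻ : ∀ {w} → w ≢ v → w ∈ closedNeighbours → w ∈ neighbours
  ∈closedNeighbours⁻ w≢v =
    [ id , (λ w∈⁅v⁆ → contradiction (x∈⁅y⁆⇒x≡y v w∈⁅v⁆) w≢v) ]′
      ∘ x∈p∪q⁻ neighbours ⁅ v ⁆

  v∉neighbours : v ∉ neighbours
  v∉neighbours = adj-irrefl refl ∘ ∈neighbours⁻

  toggleEdgesAt : Vec (Subset n) k → Vec (Subset n) (suc (suc k))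
  toggleEdgesAt C = closedNeighbours ∷ neighbours ∷ C

  -- Of the two new sets only `closedNeighbours` contains `v`, so a pair at `v` gains at most one.
  joint-toggleEdgesAt-adjacent : ∀ {w} (C : Vec (Subset n) k) → Adj v w →
    joint v w (toggleEdgesAt C) ≡ suc (joint v w C)
  joint-toggleEdgesAt-adjacent C vw = trans
    (joint-∷-∈ (neighbours ∷ C) (x∈p∪q⁺ (inj₂ (x∈⁅x⁆ v))) (x∈p∪q⁺ (inj₁ (∈neighbours⁺ vw))))
    (cong suc (joint-∷-∉ {u = v} C (v∉neighbours ∘ proj₁)))

  joint-toggleEdgesAt-nonadjacent : ∀ {w} (C : Vec (Subset n) k) → w ≢ v → ¬ Adj v w →
    joint v w (toggleEdgesAt C) ≡ joint v w C
  joint-toggleEdgesAt-nonadjacent C w≢v ¬vw = trans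
    (joint-∷-∉ {u = v} (neighbours ∷ C) (¬vw ∘ ∈neighbours⁻ ∘ ∈closedNeighbours⁻ w≢v ∘ proj₂))
    (joint-∷-∉ {u = v} C (v∉neighbours ∘ proj₁))

  -- The two new sets differ only in `v`, so the count grows by 2 or by 0. As `parity` recurses in
  -- steps of two, both cases give the same type; an equality of types can be used in a `rewrite`.
  odd-toggleEdgesAt-away : ∀ {u w} (C : Vec (Subset n) k) → u ≢ v → w ≢ v →
    Odd (joint u w (toggleEdgesAt C)) ≡ Odd (joint u w C)
  odd-toggleEdgesAt-away {u = u} {w} C u≢v w≢v with u ∈? neighbours ×-dec w ∈? neighbours
  ... | yes (u∈N , w∈N) = cong Odd (trans
    (joint-∷-∈ (neighbours ∷ C) (x∈p∪q⁺ (inj₁ u∈N)) (x∈p∪q⁺ (inj₁ w∈N)))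
    (cong suc (joint-∷-∈ C u∈N w∈N)))
  ... | no ∉N = cong Odd (trans
    (joint-∷-∉ (neighbours ∷ C)
      (λ (u∈A , w∈A) → ∉N (∈closedNeighbours⁻ u≢v u∈A , ∈closedNeighbours⁻ w≢v w∈A)))
    (joint-∷-∉ C ∉N))

  module _ (C : Vec (Subset n) k) (isC : IsComplementationSystem deleteEdgesAt C) where

    -- An odd count would be an edge of `deleteEdgesAt` at `v`, which carries a proof of `v ≢ v`.
    joint-even : ∀ {w} → w ≢ v → ¬ Odd (joint v w C)
    joint-even {w} w≢v odd =
      proj₁ (proj₂ (Equivalence.from (isC v w (w≢v ∘ sym)) odd)) refl

    adj⇔odd-toggleEdgesAt : ∀ {w} → w ≢ v → Adj v w ⇔ Odd (joint v w (toggleEdgesAt C))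
    adj⇔odd-toggleEdgesAt {w} w≢v with adj? v w
    ... | yes vw = mk⇔
      (λ _ → subst Odd (sym (joint-toggleEdgesAt-adjacent C vw))
                       (¬odd⇒odd-suc (joint v w C) (joint-even w≢v)))
      (λ _ → vw)
    ... | no ¬vw = mk⇔
      (λ vw → contradiction vw ¬vw)
      (λ odd → contradiction (subst Odd (joint-toggleEdgesAt-nonadjacent C w≢v ¬vw) odd)
                             (joint-even w≢v))

    toggleEdgesAt-isComplementationSystem : IsComplementationSystem G (toggleEdgesAt C)
    toggleEdgesAt-isComplementationSystem u w u≢w with u ≟ v | w ≟ v
    ... | yes refl | _ = adj⇔odd-toggleEdgesAt (u≢w ∘ sym)
    -- Symmetry of `joint` and of adjacency moves `v` to the first place.
    ... | no _ | yes refl rewrite joint-comm u v (toggleEdgesAt C) =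
      mk⇔ (to ∘ adj-sym) (adj-sym ∘ from)
      where open Equivalence (adj⇔odd-toggleEdgesAt u≢w)
    ... | no u≢v | no w≢v rewrite odd-toggleEdgesAt-away C u≢v w≢v =
      mk⇔ (λ uw → to (uw , u≢v , w≢v)) (proj₁ ∘ from)
      where open Equivalence (isC u w u≢w)

  c₂≤2+c₂-deleteEdgesAt : c₂ G ≤ suc (suc (c₂ deleteEdgesAt))
  c₂≤2+c₂-deleteEdgesAt =
    let _ , (C , isC) , _ = c₂-minimum deleteEdgesAt
    in proj₂ (proj₂ (c₂-minimum G)) _ (toggleEdgesAt C , toggleEdgesAt-isComplementationSystem C isC)

  -- A surviving edge avoids `v`, so the endpoint that covers it is still in `S - v`.
  deleteEdgesAt-isVertexCover : ∀ {S} → IsVertexCover G S → IsVertexCover deleteEdgesAt (S - v)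
  deleteEdgesAt-isVertexCover cover u w (uw , u≢v , w≢v) =
    Sum.map (λ u∈S → x∈p∧x≢y⇒x∈p-y u∈S u≢v) (λ w∈S → x∈p∧x≢y⇒x∈p-y w∈S w≢v) (cover u w uw)

-- The empty family works: every count is 0, which is not odd.
edgeless⇒c₂≤0 : (G : Graph n) → (∀ u w → ¬ Graph.Adj G u w) → c₂ G ≤ 0
edgeless⇒c₂≤0 G ¬adj =
  proj₂ (proj₂ (c₂-minimum G)) 0 ([] , λ u w _ → mk⇔ (λ uw → contradiction uw (¬adj u w)) λ ())

-- Induction on the bound `k`, spending one vertex of `S` per round. The product is written `k * 2`
-- because `suc k * 2` reduces to `2 + k * 2`, one pair of sets more.
vertexCover⇒c₂≤ : ∀ (G : Graph n) {S} → IsVertexCover G S → ∣ S ∣ ≤ k → c₂ G ≤ k * 2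
vertexCover⇒c₂≤ G {S} cover ∣S∣≤k with nonempty? S
... | no empty = ≤-trans
  (edgeless⇒c₂≤0 G λ u w uw →
    [ (λ u∈S → empty (u , u∈S)) , (λ w∈S → empty (w , w∈S)) ]′ (cover u w uw))
  z≤n
vertexCover⇒c₂≤ {k = zero} G cover ∣S∣≤0 | yes (v , v∈S) =
  contradiction (<-≤-trans (x∈p⇒∣p-x∣<∣p∣ v∈S) ∣S∣≤0) λ ()
vertexCover⇒c₂≤ {k = suc k} G cover ∣S∣≤1+k | yes (v , v∈S) = ≤-trans
  (c₂≤2+c₂-deleteEdgesAt G v)
  (s≤s (s≤s (vertexCover⇒c₂≤ (deleteEdgesAt G v) (deleteEdgesAt-isVertexCover G v cover)
    -- Since `v` is in `S`, removing it drops the size strictly below `suc k`, that is, to at most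
    -- `k`.
    (s≤s⁻¹ (<-≤-trans (x∈p⇒∣p-x∣<∣p∣ v∈S) ∣S∣≤1+k)))))

theorem3p5 : ∀ (n : ℕ) (G : Graph n) → c₂ G ≤ 2 * τ G
theorem3p5 n G =
  let _ , (S , cover , ∣S∣≡τ) , _ = τ-minimum G
  in subst (c₂ G ≤_) (*-comm (τ G) 2) (vertexCover⇒c₂≤ G cover (≤-reflexive ∣S∣≡τ))
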